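{- For every positive integer $t$ there exists an integer $L_t$ such that the following holds. Let $G$ be a finite group (not necessarily abelian, written additively) such that the smallest prime divisor $p$ of $|G|$ satisfies $p>t(2t+1)$. Let $M=[a_1^{\lambda_1},\dots,a_n^{\lambda_n}]$ be a multiset of non-identity elements of $G$ (with $a_1,\dots,a_n$ distinct) such that $\lambda_1+\lambda_2+\dots+\lambda_n\ge L_t$. Then there exists a realization $W=(w_0,\dots,w_{\lambda_1+\dots+\lambda_n})$ of $M$ such that $w_i\ne w_j$ whenever $1\le|i-j|\le t$.
   Context: $[a_1^{\lambda_1},\dots,a_n^{\lambda_n}]$ denotes the multiset containing $a_i$ with multiplicity $\lambda_i$. For a multiset $M$, $\pm M$ denotes the multiset $[x,-x : x\in M]$ (with multiplicity). A walk $W=(w_0,\dots,w_\ell)$ in $G$ has differences $\delta_i$ defined by $w_i=w_{i-1}+\delta_i$ ($1\le i\le \ell$), and $\Delta(W)=\pm[\delta_1,\dots,\delta_\ell]$. A realization of $M$ is a walk $W$ (in the Cayley graph $Cay[G:\pm M]$, vertices may repeat) with $\Delta(W)=\pm M$; equivalently, there is an ordering $(x_1,\dots,x_\ell)$ of $M$ and signs $\varepsilon_i\in\{\pm1\}$ with $w_i=w_{i-1}+\varepsilon_i x_i$. -}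

module Defs where

open import Algebra.Bundles using (Group)
open import Data.Fin.Base using (Fin; suc; inject₁; toℕ)
open import Data.List.Base using (List; []; _∷_; concat; concatMap; tabulate; replicate)
import Data.List.Membership.Setoid as Membership
import Data.List.Relation.Binary.Permutation.Setoid as Permutation
open import Data.Nat.Base using (ℕ; _≤_; ∣_-_∣)
open import Data.Nat.Divisibility using (_∣_)
open import Data.Nat.Primality using (Prime)
open import Data.Product.Base using (_×_)
open import Function.Bundles using (Inverse)
open import Level using (_⊔_)
import Relation.Binary.PropositionalEquality as ≡
open import Relation.Nullary.Negation using (¬_)

IsSmallestPrimeDivisor : ℕ → ℕ → Set
IsSmallestPrimeDivisor p N =
  Prime p × p ∣ N × (∀ q → Prime q → q ∣ N → p ≤ q)

-- The group is written additively but is not assumed abelian.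
module _ {c ℓ} (G : Group c ℓ) where

  open Group G using (Carrier; _≈_; setoid)
    renaming (_∙_ to infixl 6 _+_; ε to 0#; _⁻¹ to infix 8 -_)
  open Membership setoid using (_∈_)
  open Permutation setoid using (_↭_)

  -- G is finite, with exactly N elements up to the group's equality.
  HasOrder : ℕ → Set (c ⊔ ℓ)
  HasOrder N = Inverse setoid (≡.setoid (Fin N))

  NonIdentity : Carrier → Set ℓ
  NonIdentity x = ¬ (x ≈ 0#)

  -- Multisets are lists compared by _↭_; this is [a₁^m₁, …, aₙ^mₙ].
  multiset : ∀ {n} → (Fin n → Carrier) → (Fin n → ℕ) → List Carrier
  multiset a m = concat (tabulate (λ i → replicate (m i) (a i)))

  ± : List Carrier → List Carrier
  ± = concatMap (λ x → x ∷ - x ∷ [])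

  -- Adjacency x ~ x + s (s ∈ S) in Cay[G : S].
  CayAdj : List Carrier → Carrier → Carrier → Set (c ⊔ ℓ)
  CayAdj S x y = (- x + y) ∈ S

  -- δ w i is the unique solution of w (i + 1) = w i + δ w i; the index
  -- is shifted by one, so that differences are numbered from 0.
  δ : ∀ {k} → (Fin (ℕ.suc k) → Carrier) → Fin k → Carrier
  δ w i = - w (inject₁ i) + w (suc i)

  Δ : ∀ {k} → (Fin (ℕ.suc k) → Carrier) → List Carrier
  Δ w = ± (tabulate (δ w))

  record IsRealization (M : List Carrier) {k : ℕ}
                       (w : Fin (ℕ.suc k) → Carrier) : Set (c ⊔ ℓ) where
    field
      isWalk : ∀ (i : Fin k) → CayAdj (± M) (w (inject₁ i)) (w (suc i))
      Δ↭±M   : Δ w ↭ ± M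

  LocallySimple : ℕ → ∀ {k} → (Fin (ℕ.suc k) → Carrier) → Set ℓ
  LocallySimple t w =
    ∀ i j → 1 ≤ ∣ toℕ i - toℕ j ∣ → ∣ toℕ i - toℕ j ∣ ≤ t → ¬ (w i ≈ w j)

{-# OPTIONS --safe #-}
-- A walk is determined by its differences d₁, …, d_k, and it is locally simple
-- iff no block of at most t consecutive differences sums to 0.  By Lagrange no
-- element other than 0 is killed by a positive integer below p, so for a and
-- y ≠ 0 at most one of the signs of ± y admits a relation j (± y) + i a = 0
-- with i, j ≤ t; hence blocks of at least t equal elements can be concatenated
-- after choosing signs.
--
-- If M has many distinct elements, reserve a set P in which no sum of at most t
-- distinct elements, in any order, vanishes.  Concatenate the elements of
-- multiplicity at least t as blocks, append the others greedily as long as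
-- possible, and separate the boundedly many left over by suitable elements of P.
-- After t further greedy steps inside P, the rest of P can follow in any order.
-- If M has few distinct elements, some a has a large multiplicity; the elements
-- of multiplicity below t are inserted between blocks a^t, and the remaining
-- elements follow as blocks.
--
-- Lists of differences are built by prepending, that is, from the end of the walk.
module Submission where

open import Defs
open import Algebra.Bundles using (CommutativeMonoid; Group)
import Algebra.Properties.CommutativeSemigroup as CommutativeSemigroupProperties
import Algebra.Properties.Group as GroupProperties
import Algebra.Properties.Monoid.Mult as MonoidMult
open import Data.Fin.Base using (Fin; zero; suc; punchIn; toℕ; inject₁)
import Data.Fin.Properties as Fin
open import Data.List.Base using (List; []; _∷_; _++_; length; map; take; drop; lookup; replicate;
  filter; applyUpTo; tabulate; cartesianProductWith)
import Data.List.Membership.DecSetoid as DecMembership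
open import Data.List.Membership.Propositional using () renaming (_∈_ to _∈≡_)
import Data.List.Membership.Propositional.Properties as ∈≡
import Data.List.Membership.Setoid as Membership
import Data.List.Membership.Setoid.Properties as Membershipₚ
open import Data.List.Properties using (++-assoc; concatMap-++; length-++; length-applyUpTo; length-map; length-replicate;
  length-tabulate; length-take; tabulate-lookup; take++drop≡id; take-[])
open import Data.List.Relation.Binary.Permutation.Propositional using (_↭_; refl; prep; swap; trans;
  ↭-sym; ↭-reflexive; ↭⇒↭ₛ′; module PermutationReasoning)
import Data.List.Relation.Binary.Permutation.Propositional.Properties as ↭
import Data.List.Relation.Binary.Permutation.Setoid as SetoidPermutation
import Data.List.Relation.Binary.Permutation.Setoid.Properties as SetoidPermutationₚ
import Data.List.Relation.Binary.Pointwise as Pointwise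
open Pointwise using (Pointwise; []; _∷_)
open import Data.List.Relation.Unary.All as All using (All; []; _∷_)
import Data.List.Relation.Unary.All.Properties as Allₚ
open import Data.List.Relation.Unary.AllPairs using ([]; _∷_)
open import Data.List.Relation.Unary.Any as Any using (here; there)
import Data.List.Relation.Unary.Unique.Setoid as Unique
import Data.List.Relation.Unary.Unique.Setoid.Properties as Uniqueₚ
open import Data.Nat.Base using (ℕ; zero; suc; _+_; _*_; _∸_; _⊓_; _≤_; _<_; z≤n; s≤s)
open import Data.Nat.Divisibility using (_∣_; _∣0; ∣-refl; ∣-trans; ∣m∣n⇒∣m+n; ∣⇒≤; m∣m*n)
open import Data.Nat.Induction using (<-rec)
open import Data.Nat.ListAction using (sum; product)
open import Data.Nat.Primality using (Prime)
open import Data.Nat.Primality.Factorisation using (factorise)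
open import Data.Nat.Properties
open import Data.Nat.Tactic.RingSolver using (solve-∀)
open import Data.Product.Base using (∃-syntax; _×_; _,_; proj₁; proj₂)
open import Data.Sum.Base using (_⊎_; inj₁; inj₂; [_,_]′)
open import Function.Base using (_∘_)
open import Function.Bundles using (Inverse)
open import Function.Definitions using (Injective)
open import Level using (Level; _⊔_)
open import Relation.Binary.Bundles using (DecSetoid; Setoid)
open import Relation.Binary.Definitions using (tri<; tri≈; tri>) renaming (Decidable to Decidable₂)
open import Relation.Binary.PropositionalEquality as ≡ using (_≡_; cong; cong₂; subst)
import Relation.Binary.Reasoning.Setoid as SetoidReasoning
open import Relation.Nullary using (¬_; Dec; yes; no; contradiction; ¬?; _×-dec_)
open import Relation.Nullary.Decidable using (map′)
open import Relation.Unary using (Pred; Decidable)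

-- Lists, least witnesses and prime divisors.

private variable
  α β : Level
  A B C : Set α

replicate-+ : ∀ m n {x : A} → replicate (m + n) x ≡ replicate m x ++ replicate n x
replicate-+ zero    n = ≡.refl
replicate-+ (suc m) n = cong (_ ∷_) (replicate-+ m n)

take-++ˡ : ∀ l (xs : List A) {ys} → l ≤ length xs → take l (xs ++ ys) ≡ take l xs
take-++ˡ zero    xs       _         = ≡.refl
take-++ˡ (suc l) (x ∷ xs) (s≤s l≤)  = cong (x ∷_) (take-++ˡ l xs l≤)

++-interchange : ∀ (ws xs ys zs : List A) → (ws ++ xs) ++ (ys ++ zs) ↭ (ws ++ ys) ++ (xs ++ zs)
++-interchange {A = A} = CommutativeSemigroupProperties.interchange
  (CommutativeMonoid.commutativeSemigroup (↭.++-commutativeMonoid {A = A}))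

length-cartesianProductWith : ∀ (f : A → B → C) xs ys →
  length (cartesianProductWith f xs ys) ≡ length xs * length ys
length-cartesianProductWith f []       ys = ≡.refl
length-cartesianProductWith f (x ∷ xs) ys = ≡.trans (length-++ (map (f x) ys))
  (cong₂ _+_ (length-map (f x) ys) (length-cartesianProductWith f xs ys))

extract : ∀ {P : Pred A β} → Decidable P → ∀ xs →
  (∃[ x ] ∃[ ys ] (xs ↭ x ∷ ys × P x)) ⊎ All (¬_ ∘ P) xs
extract P? [] = inj₂ []
extract P? (x ∷ xs) with P? x | extract P? xs
... | yes Px | _                            = inj₁ (x , xs , refl , Px)
... | no _   | inj₁ (y , ys , xs↭ , Py)     = inj₁ (y , x ∷ ys , trans (prep x xs↭) (swap x y refl) , Py)
... | no ¬Px | inj₂ ¬Pxs                    = inj₂ (¬Px ∷ ¬Pxs)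

-- The bookkeeping of `many-distinct`: `ds₂` and `ds₃` are the elements of `Q` and `L` placed
-- greedily, `Y₂` and `Y₃` those left over, `ds₄` combines these with part of `P`, and `W` and `R'`
-- make up the rest `R` of `P`.
reassemble : ∀ {R' W R ds₄ ds₃ ds₂ ds₁ Y₃ Y₂ P L Q : List A} →
  W ++ R' ↭ R → ds₄ ++ R ↭ (Y₃ ++ Y₂) ++ P → L ↭ ds₃ ++ Y₃ → Q ↭ ds₂ ++ Y₂ →
  R' ++ W ++ ds₄ ++ ds₃ ++ ds₂ ++ ds₁ ++ [] ↭ (L ++ ds₁) ++ (Q ++ P)
reassemble {R' = R'} {W} {R} {ds₄} {ds₃} {ds₂} {ds₁} {Y₃} {Y₂} {P} {L} {Q} W↭ ds₄↭ L↭ Q↭ = begin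
  R' ++ W ++ ds₄ ++ ds₃ ++ ds₂ ++ ds₁ ++ []
    ↭⟨ ↭.++⁺ˡ R' (↭.++⁺ˡ W (↭.++⁺ˡ ds₄ (↭.++⁺ˡ ds₃ (↭.++⁺ˡ ds₂ (↭.++-identityʳ ds₁))))) ⟩
  R' ++ W ++ ds₄ ++ ds₃ ++ ds₂ ++ ds₁             ≡⟨ ++-assoc R' W _ ⟨
  (R' ++ W) ++ ds₄ ++ ds₃ ++ ds₂ ++ ds₁           ↭⟨ ↭.++⁺ʳ _ (trans (↭.++-comm R' W) W↭) ⟩
  R ++ ds₄ ++ ds₃ ++ ds₂ ++ ds₁                   ≡⟨ ++-assoc R ds₄ _ ⟨
  (R ++ ds₄) ++ ds₃ ++ ds₂ ++ ds₁
    ↭⟨ ↭.++⁺ (trans (↭.++-comm R ds₄) ds₄↭) (↭-reflexive (≡.sym (++-assoc ds₃ ds₂ ds₁))) ⟩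
  ((Y₃ ++ Y₂) ++ P) ++ ((ds₃ ++ ds₂) ++ ds₁)      ↭⟨ ++-interchange (Y₃ ++ Y₂) P (ds₃ ++ ds₂) ds₁ ⟩
  ((Y₃ ++ Y₂) ++ (ds₃ ++ ds₂)) ++ (P ++ ds₁)      ↭⟨ ↭.++⁺ (++-interchange Y₃ Y₂ ds₃ ds₂) (↭.++-comm P ds₁) ⟩
  ((Y₃ ++ ds₃) ++ (Y₂ ++ ds₂)) ++ (ds₁ ++ P)
    ↭⟨ ↭.++⁺ʳ _ (↭.++⁺ (trans (↭.++-comm Y₃ ds₃) (↭-sym L↭)) (trans (↭.++-comm Y₂ ds₂) (↭-sym Q↭))) ⟩
  (L ++ Q) ++ (ds₁ ++ P)                          ↭⟨ ++-interchange L Q ds₁ P ⟩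
  (L ++ ds₁) ++ (Q ++ P)                          ∎
  where open PermutationReasoning

m≡m⊓1+[m∸1] : ∀ m → m ≡ m ⊓ 1 + (m ∸ 1)
m≡m⊓1+[m∸1] zero    = ≡.refl
m≡m⊓1+[m∸1] (suc m) = cong (λ k → suc k + m) (≡.sym (⊓-zeroʳ m))

n≤n*[1+m⊓1] : ∀ n m → n ≤ n * (suc m ⊓ 1)
n≤n*[1+m⊓1] n m = ≤-reflexive (≡.sym (≡.trans (cong (λ l → n * suc l) (⊓-zeroʳ m)) (*-identityʳ n)))

least : ∀ {p} {P : ℕ → Set p} → Decidable P → ∀ n → P n →
        ∃[ d ] (d ≤ n × P d × (∀ {i} → i < d → ¬ P i))
least {P = P} P? = <-rec _ λ n rec Pn → go n rec Pn (anyUpTo? P? n)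
  where
  go : ∀ n → (∀ {k} → k < n → P k → ∃[ d ] (d ≤ k × P d × (∀ {i} → i < d → ¬ P i))) →
       P n → Dec (∃[ k ] (k < n × P k)) → ∃[ d ] (d ≤ n × P d × (∀ {i} → i < d → ¬ P i))
  go n rec Pn (yes (k , k<n , Pk)) with rec k<n Pk
  ... | d , d≤k , Pd , min = d , ≤-trans d≤k (<⇒≤ k<n) , Pd , min
  go n rec Pn (no ¬small) = n , ≤-refl , Pn , λ i<n Pi → ¬small (_ , i<n , Pi)

∃-prime-divisor : ∀ n → 1 < n → ∃[ q ] (Prime q × q ∣ n)
∃-prime-divisor n@(suc _) 1<n with factorise n
... | record { factors = [] ; isFactorisation = eq } = contradiction (≡.sym eq) (<⇒≢ 1<n)
... | record { factors = q ∷ qs ; isFactorisation = eq ; factorsPrime = pq ∷ _ } =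
  q , pq , subst (q ∣_) (≡.sym eq) (m∣m*n (product qs))

-- The pigeonhole principle up to setoid equality.

module _ {c ℓ} (S : Setoid c ℓ) where
  open Setoid S using (_≈_)
  open Membership S using (_∈_)
  open Unique S using (Unique)

  ∈-remove : ∀ {x z} ys {zs w} → x ≈ w → ¬ (x ≈ z) → z ∈ ys ++ w ∷ zs → z ∈ ys ++ zs
  ∈-remove []       x≈w x≉z (here z≈w)  = contradiction (Setoid.trans S x≈w (Setoid.sym S z≈w)) x≉z
  ∈-remove []       x≈w x≉z (there z∈)  = z∈
  ∈-remove (y ∷ ys) x≈w x≉z (here z≈y)  = here z≈y
  ∈-remove (y ∷ ys) x≈w x≉z (there z∈)  = there (∈-remove ys x≈w x≉z z∈)

  Unique-⊆⇒length-≤ : ∀ {xs} ys → Unique xs → (∀ {z} → z ∈ xs → z ∈ ys) → length xs ≤ length ys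
  Unique-⊆⇒length-≤ {[]}     ys _ _ = z≤n
  Unique-⊆⇒length-≤ {x ∷ xs} ys (x∉ ∷ xs!) xs⊆ys
    with ys₁ , ys₂ , w , x≈w , eq ← Membershipₚ.∈-∃++ S (xs⊆ys (here (Setoid.refl S)))
    = begin
      suc (length xs)                  ≤⟨ s≤s (Unique-⊆⇒length-≤ (ys₁ ++ ys₂) xs! sub) ⟩
      suc (length (ys₁ ++ ys₂))        ≡⟨ cong suc (length-++ ys₁) ⟩
      suc (length ys₁ + length ys₂)    ≡⟨ +-suc (length ys₁) (length ys₂) ⟨
      length ys₁ + suc (length ys₂)    ≡⟨ length-++ ys₁ ⟨
      length (ys₁ ++ w ∷ ys₂)          ≡⟨ Pointwise.Pointwise-length eq ⟨
      length ys                        ∎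
    where
    open ≤-Reasoning
    sub : ∀ {z} → z ∈ xs → z ∈ ys₁ ++ ys₂
    sub z∈xs = ∈-remove ys₁ x≈w
      (λ x≈z → Membershipₚ.All[≉]⇒∉ S x∉ (Membershipₚ.∈-resp-≈ S (Setoid.sym S x≈z) z∈xs))
      (Membershipₚ.∈-resp-≋ S eq (xs⊆ys (there z∈xs)))

-- Multiples in a group and the order of an element.

module Multiples {c ℓ} (G : Group c ℓ) where
  open Group G renaming (refl to ≈-refl; sym to ≈-sym; trans to ≈-trans; reflexive to ≈-reflexive)
  open GroupProperties G
  open MonoidMult monoid public renaming (_×_ to infixr 8 _·_)
  open SetoidReasoning setoid

  ·-comm-self : ∀ n x → n · x ∙ x ≈ x ∙ n · x
  ·-comm-self zero    x = ≈-trans (identityˡ x) (≈-sym (identityʳ x))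
  ·-comm-self (suc n) x = ≈-trans (assoc x (n · x) x) (∙-congˡ (·-comm-self n x))

  ·-⁻¹ : ∀ n x → n · (x ⁻¹) ≈ (n · x) ⁻¹
  ·-⁻¹ zero    x = ≈-sym ε⁻¹≈ε
  ·-⁻¹ (suc n) x = begin
    x ⁻¹ ∙ n · (x ⁻¹)   ≈⟨ ∙-congˡ (·-⁻¹ n x) ⟩
    x ⁻¹ ∙ (n · x) ⁻¹   ≈⟨ ⁻¹-anti-homo-∙ (n · x) x ⟨
    (n · x ∙ x) ⁻¹      ≈⟨ ⁻¹-cong (·-comm-self n x) ⟩
    (x ∙ n · x) ⁻¹      ∎

  ·-ε : ∀ n → n · ε ≈ ε
  ·-ε zero    = ≈-refl
  ·-ε (suc n) = ≈-trans (identityˡ _) (·-ε n)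

  ·-cancel : ∀ {i j} x → i ≤ j → i · x ≈ j · x → (j ∸ i) · x ≈ ε
  ·-cancel {i} {j} x i≤j eq = ∙-cancelˡ (i · x) _ _ (begin
    i · x ∙ (j ∸ i) · x   ≈⟨ ×-homo-+ x i (j ∸ i) ⟨
    (i + (j ∸ i)) · x     ≡⟨ cong (_· x) (m+[n∸m]≡n i≤j) ⟩
    j · x                 ≈⟨ eq ⟨
    i · x                 ≈⟨ identityʳ _ ⟨
    i · x ∙ ε             ∎)

  TorsionFreeUpTo : ℕ → Set (c ⊔ ℓ)
  TorsionFreeUpTo b = ∀ k x → 1 ≤ k → k ≤ b → k · x ≈ ε → x ≈ ε

groupDecSetoid : ∀ {c ℓ} (G : Group c ℓ) → Decidable₂ (Group._≈_ G) → DecSetoid c ℓ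
groupDecSetoid G _≟_ = record
  { isDecEquivalence = record { isEquivalence = Group.isEquivalence G ; _≟_ = _≟_ } }

module _ {c ℓ} (G : Group c ℓ) (_≟_ : Decidable₂ (Group._≈_ G)) where
  open Group G renaming (refl to ≈-refl; sym to ≈-sym; trans to ≈-trans; reflexive to ≈-reflexive)
  open GroupProperties G
  open Multiples G
  open Membership setoid using (_∈_; _∉_)
  open DecMembership (groupDecSetoid G _≟_) using (_∈?_)
  open Unique setoid using (Unique)

  -- A set stable under translation by x splits into translates of ⟨x⟩.
  stable⇒order-∣-length :
    ∀ x d → d · x ≈ ε → 1 ≤ d → (∀ {i} → i < d → ¬ (1 ≤ i × i · x ≈ ε)) →
    ∀ fuel U → length U ≤ fuel → Unique U → (∀ {y} → y ∈ U → x ∙ y ∈ U) → d ∣ length U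
  stable⇒order-∣-length x d dx≈ε 1≤d min = go
    where
    go : ∀ fuel U → length U ≤ fuel → Unique U → (∀ {y} → y ∈ U → x ∙ y ∈ U) → d ∣ length U
    go _          []      _    _  _      = d ∣0
    go (suc fuel) (u ∷ U₀) (s≤s l≤) U! stable =
      subst (d ∣_) (≡.sym lengthU)
        (∣m∣n⇒∣m+n ∣-refl (go fuel rest (≤-pred (≤-trans rest<U (s≤s l≤))) rest! rest-stable))
      where
      U = u ∷ U₀
      orbit = applyUpTo (λ i → i · x ∙ u) d
      outside? = λ y → ¬? (y ∈? orbit)
      rest = filter outside? U

      ∉-orbit-resp : ∀ {y z} → y ≈ z → y ∉ orbit → z ∉ orbit
      ∉-orbit-resp y≈z y∉ z∈ = y∉ (Membershipₚ.∈-resp-≈ setoid (≈-sym y≈z) z∈)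

      orbit! : Unique orbit
      orbit! = Uniqueₚ.applyUpTo⁺₁ setoid _ d λ {i} {j} i<j j<d eq →
        min (≤-<-trans (m∸n≤m j i) j<d)
          (m<n⇒0<n∸m i<j , ·-cancel x (<⇒≤ i<j) (∙-cancelʳ u _ _ eq))

      rest! : Unique rest
      rest! = Uniqueₚ.filter⁺ setoid outside? U!

      ∈-orbit⁺ : ∀ i → i < d → ∀ {y} → y ≈ i · x ∙ u → y ∈ orbit
      ∈-orbit⁺ i i<d y≈ = Membershipₚ.∈-resp-≈ setoid (≈-sym y≈) (Membershipₚ.∈-applyUpTo⁺ setoid _ i<d)

      multiples∈U : ∀ i → i · x ∙ u ∈ U
      multiples∈U zero    = here (identityˡ u)
      multiples∈U (suc i) = Membershipₚ.∈-resp-≈ setoid (≈-sym (assoc x (i · x) u)) (stable (multiples∈U i))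

      orbit⊆U : ∀ {y} → y ∈ orbit → y ∈ U
      orbit⊆U y∈ with i , _ , y≈ ← Membershipₚ.∈-applyUpTo⁻ setoid _ y∈ =
        Membershipₚ.∈-resp-≈ setoid (≈-sym y≈) (multiples∈U i)

      rest⁻ : ∀ {y} → y ∈ rest → y ∈ U × y ∉ orbit
      rest⁻ = Membershipₚ.∈-filter⁻ setoid outside? ∉-orbit-resp

      translate⁻ : ∀ {y} → x ∙ y ∈ orbit → y ∈ orbit
      translate⁻ {y} xy∈ with Membershipₚ.∈-applyUpTo⁻ setoid _ xy∈
      ... | suc i , i<d , xy≈ = ∈-orbit⁺ i (<-trans (n<1+n i) i<d)
        (∙-cancelˡ x _ _ (≈-trans xy≈ (assoc x (i · x) u)))
      -- Here x + y = u = d x + u, so y is the last entry of the orbit.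
      ... | zero  , _ , xy≈ = ∈-orbit⁺ (d ∸ 1) (≤-reflexive d-1+1≡d)
        (∙-cancelˡ x _ _ (≈-trans xy≈ (≈-trans
          (∙-congʳ (≈-sym (subst (λ e → e · x ≈ ε) (≡.sym d-1+1≡d) dx≈ε)))
          (assoc x ((d ∸ 1) · x) u))))
        where
        d-1+1≡d : suc (d ∸ 1) ≡ d
        d-1+1≡d = m+[n∸m]≡n 1≤d

      rest-stable : ∀ {y} → y ∈ rest → x ∙ y ∈ rest
      rest-stable y∈ with y∈U , y∉ ← rest⁻ y∈ =
        Membershipₚ.∈-filter⁺ setoid outside? ∉-orbit-resp (stable y∈U) (y∉ ∘ translate⁻)

      both : ∀ {z} → z ∈ orbit ++ rest → z ∈ U
      both z∈ = [ orbit⊆U , proj₁ ∘ rest⁻ ]′ (Membershipₚ.∈-++⁻ setoid orbit z∈)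

      cover : ∀ {z} → z ∈ U → z ∈ orbit ++ rest
      cover {z} z∈ with z ∈? orbit
      ... | yes z∈orbit = Membershipₚ.∈-++⁺ˡ setoid z∈orbit
      ... | no  z∉orbit = Membershipₚ.∈-++⁺ʳ setoid orbit
                            (Membershipₚ.∈-filter⁺ setoid outside? ∉-orbit-resp z∈ z∉orbit)

      lengthU : length U ≡ d + length rest
      lengthU = ≡.trans
        (≤-antisym (Unique-⊆⇒length-≤ setoid (orbit ++ rest) U! cover)
          (Unique-⊆⇒length-≤ setoid U
            (Uniqueₚ.++⁺ setoid orbit! rest! λ (y∈o , y∈r) → proj₂ (rest⁻ y∈r) y∈o) both))
        (≡.trans (length-++ orbit) (cong (_+ length rest) (length-applyUpTo _ d)))

      rest<U : suc (length rest) ≤ length U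
      rest<U = ≤-trans (+-monoˡ-≤ (length rest) 1≤d) (≤-reflexive (≡.sym lengthU))

module _ {c ℓ} {G : Group c ℓ} {N : ℕ} (order : HasOrder G N) where
  open Group G renaming (refl to ≈-refl; sym to ≈-sym; trans to ≈-trans; reflexive to ≈-reflexive)
  open Multiples G
  open Inverse order using (to; from; to-cong; strictlyInverseʳ; strictlyInverseˡ)

  HasOrder⇒≟ : Decidable₂ _≈_
  HasOrder⇒≟ x y = map′
    (λ eq → ≈-trans (≈-sym (strictlyInverseʳ x)) (≈-trans (≈-reflexive (cong from eq)) (strictlyInverseʳ y)))
    to-cong (to x Fin.≟ to y)

  order-∣ : ∀ x d → d · x ≈ ε → 1 ≤ d → (∀ {i} → i < d → ¬ (1 ≤ i × i · x ≈ ε)) → d ∣ N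
  order-∣ x d dx≈ε 1≤d min = subst (d ∣_) (length-tabulate from)
    (stable⇒order-∣-length G HasOrder⇒≟ x d dx≈ε 1≤d min _ (tabulate from) ≤-refl
      (Uniqueₚ.tabulate⁺ setoid λ {i} {j} eq →
        ≡.trans (≡.sym (strictlyInverseˡ i)) (≡.trans (to-cong eq) (strictlyInverseˡ j)))
      λ _ → Membershipₚ.∈-resp-≈ setoid (strictlyInverseʳ _) (Membershipₚ.∈-tabulate⁺ setoid _))

  -- The least positive `d` that kills `x` divides `N`. If `d` were at least 2, a prime divisor `q`
  -- of `d` would give p ≤ q ≤ d ≤ k < p.
  torsion-free-below : ∀ {p} → IsSmallestPrimeDivisor p N →
    ∀ k x → 1 ≤ k → k < p → k · x ≈ ε → x ≈ ε
  torsion-free-below {p} (_ , _ , smallest) k x 1≤k k<p kx≈ε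
    with least (λ i → (1 ≤? i) ×-dec HasOrder⇒≟ (i · x) ε) k (1≤k , kx≈ε)
  ... | 1 , _ , (_ , x≈ε) , _ = ≈-trans (≈-sym (identityʳ x)) x≈ε
  ... | d@(suc (suc _)) , d≤k , (1≤d , dx≈ε) , min
    with q , q-prime , q∣d ← ∃-prime-divisor d (s≤s (s≤s z≤n)) =
    contradiction (smallest q q-prime (∣-trans q∣d (order-∣ x d dx≈ε 1≤d min)))
      (<⇒≱ (≤-<-trans (≤-trans (∣⇒≤ q∣d) d≤k) k<p))

-- Multisets given by multiplicities.

module Multiset {c ℓ} (G : Group c ℓ) where
  open Group G using (Carrier; _≈_; setoid)
  open Unique setoid using (Unique)

  multiset-+ : ∀ {n} (x : Fin n → Carrier) {m k l : Fin n → ℕ} → (∀ i → m i ≡ k i + l i) →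
    multiset G x m ↭ multiset G x k ++ multiset G x l
  multiset-+ {zero}  x eq = refl
  multiset-+ {suc n} x {m} {k} {l} eq = begin
    replicate (m zero) (x zero) ++ multiset G (x ∘ suc) (m ∘ suc)
      ≡⟨ cong (_++ multiset G (x ∘ suc) (m ∘ suc))
           (≡.trans (cong (λ i → replicate i (x zero)) (eq zero)) (replicate-+ (k zero) (l zero))) ⟩
    (replicate (k zero) (x zero) ++ replicate (l zero) (x zero)) ++ multiset G (x ∘ suc) (m ∘ suc)
      ↭⟨ ↭.++⁺ˡ (replicate (k zero) (x zero) ++ replicate (l zero) (x zero)) (multiset-+ (x ∘ suc) (eq ∘ suc)) ⟩
    (replicate (k zero) (x zero) ++ replicate (l zero) (x zero)) ++
      (multiset G (x ∘ suc) (k ∘ suc) ++ multiset G (x ∘ suc) (l ∘ suc))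
      ↭⟨ ++-interchange (replicate (k zero) (x zero)) (replicate (l zero) (x zero))
           (multiset G (x ∘ suc) (k ∘ suc)) _ ⟩
    multiset G x k ++ multiset G x l ∎
    where open PermutationReasoning

  multiset-zero : ∀ {n} (x : Fin n → Carrier) {m : Fin n → ℕ} → (∀ i → m i ≤ 0) → multiset G x m ≡ []
  multiset-zero {zero}  x m≤0 = ≡.refl
  multiset-zero {suc n} x {m} m≤0 rewrite n≤0⇒n≡0 (m≤0 zero) = multiset-zero (x ∘ suc) (m≤0 ∘ suc)

  multiset-remove : ∀ {n} (x : Fin (suc n) → Carrier) (m : Fin (suc n) → ℕ) i →
    multiset G x m ↭ replicate (m i) (x i) ++ multiset G (x ∘ punchIn i) (m ∘ punchIn i)
  multiset-remove         x m zero    = refl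
  multiset-remove {suc n} x m (suc i) = trans
    (↭.++⁺ˡ (replicate (m zero) (x zero)) (multiset-remove (x ∘ suc) (m ∘ suc) i))
    (↭.shifts (replicate (m zero) (x zero)) (replicate (m (suc i)) (x (suc i))))

  length-multiset : ∀ {n} (x : Fin n → Carrier) (m : Fin n → ℕ) → length (multiset G x m) ≡ sum (tabulate m)
  length-multiset {zero}  x m = ≡.refl
  length-multiset {suc n} x m = ≡.trans (length-++ (replicate (m zero) (x zero)))
    (cong₂ _+_ (length-replicate (m zero)) (length-multiset (x ∘ suc) (m ∘ suc)))

  All-multiset : ∀ {p} {P : Pred Carrier p} {n} (x : Fin n → Carrier) (m : Fin n → ℕ) →
    (∀ i → P (x i)) → All P (multiset G x m)
  All-multiset {n = zero}  x m Px = []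
  All-multiset {n = suc n} x m Px =
    Allₚ.++⁺ (Allₚ.replicate⁺ (m zero) (Px zero)) (All-multiset (x ∘ suc) (m ∘ suc) (Px ∘ suc))

  Unique-multiset : ∀ {n} (x : Fin n → Carrier) (m : Fin n → ℕ) → (∀ {i j} → x i ≈ x j → i ≡ j) →
    (∀ i → m i ≤ 1) → Unique (multiset G x m)
  Unique-multiset {zero}  x m inj m≤1 = []
  Unique-multiset {suc n} x m inj m≤1 with m zero | m≤1 zero
  ... | zero  | _       = Unique-multiset (x ∘ suc) (m ∘ suc) (Fin.suc-injective ∘ inj) (m≤1 ∘ suc)
  ... | suc zero | s≤s z≤n =
    All-multiset (x ∘ suc) (m ∘ suc) (λ i eq → Fin.0≢1+n (inj eq)) ∷
    Unique-multiset (x ∘ suc) (m ∘ suc) (Fin.suc-injective ∘ inj) (m≤1 ∘ suc)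

-- Equality of multisets up to signs.

module Realizing {c ℓ} (G : Group c ℓ) where
  open Group G renaming (refl to ≈-refl; sym to ≈-sym; trans to ≈-trans; reflexive to ≈-reflexive)
  open GroupProperties G using (⁻¹-involutive)
  open SetoidPermutation setoid using () renaming (_↭_ to _↭ₛ_; ↭-trans to ↭ₛ-trans; ↭-reflexive to ↭ₛ-reflexive;
    ↭-prep to ↭ₛ-prep; ↭-swap to ↭ₛ-swap; ↭-refl to ↭ₛ-refl; ↭-reflexive-≋ to ↭ₛ-reflexive-≋)
  open SetoidPermutationₚ setoid using () renaming (++⁺ to ↭ₛ-++⁺; shifts to ↭ₛ-shifts; ++⁺ˡ to ↭ₛ-++⁺ˡ)

  infix 4 _≈±_

  -- A record, so that `ds` and `M` can be inferred; unification cannot invert `±`.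
  record _≈±_ (ds M : List Carrier) : Set (c ⊔ ℓ) where
    constructor ⟨_⟩
    field ±↭ : ± G ds ↭ₛ ± G M

  ≈±-refl : ∀ {M} → M ≈± M
  ≈±-refl = ⟨ ↭ₛ-refl ⟩

  ≈±-trans : ∀ {L M N} → L ≈± M → M ≈± N → L ≈± N
  ≈±-trans ⟨ p ⟩ ⟨ q ⟩ = ⟨ ↭ₛ-trans p q ⟩

  ≈±-++ : ∀ {ds M es N} → ds ≈± M → es ≈± N → ds ++ es ≈± M ++ N
  ≈±-++ {ds} {M} {es} {N} ⟨ p ⟩ ⟨ q ⟩ = ⟨ ↭ₛ-trans (↭ₛ-reflexive (concatMap-++ _ ds es))
    (↭ₛ-trans (↭ₛ-++⁺ p q) (↭ₛ-reflexive (≡.sym (concatMap-++ _ M N)))) ⟩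

  ↭⇒≈± : ∀ {M N} → M ↭ N → M ≈± N
  ↭⇒≈± p = ⟨ go p ⟩
    where
    go : ∀ {M N} → M ↭ N → ± G M ↭ₛ ± G N
    go refl         = ↭ₛ-refl
    go (prep x p)   = ↭ₛ-prep _ (↭ₛ-prep _ (go p))
    go (swap x y p) = ↭ₛ-trans (↭ₛ-shifts (x ∷ x ⁻¹ ∷ []) (y ∷ y ⁻¹ ∷ []))
      (↭ₛ-++⁺ˡ (y ∷ y ⁻¹ ∷ x ∷ x ⁻¹ ∷ []) (go p))
    go (trans p q)  = ↭ₛ-trans (go p) (go q)

  ≈±-inverse : ∀ {x} → x ⁻¹ ∷ [] ≈± x ∷ []
  ≈±-inverse {x} = ⟨ ↭ₛ-trans (↭ₛ-swap (x ⁻¹) ((x ⁻¹) ⁻¹) ↭ₛ-refl)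
    (↭ₛ-reflexive-≋ (⁻¹-involutive x ∷ ≈-refl ∷ [])) ⟩

  ≈±-replicate : ∀ k {d x} → d ∷ [] ≈± x ∷ [] → replicate k d ≈± replicate k x
  ≈±-replicate zero    p = ≈±-refl
  ≈±-replicate (suc k) p = ≈±-++ p (≈±-replicate k p)

-- Numerical bounds and the splitting of multiplicities.

reachSize : ℕ → ℕ → ℕ
reachSize zero    m = 1
reachSize (suc k) m = suc (m * reachSize k m)

-- A reserve of m + 1 elements extends one of m elements by an element outside
-- a list of (reachSize t m)² relators.
genericBound : ℕ → ℕ → ℕ
genericBound t zero    = 0
genericBound t (suc m) = suc (reachSize t m * reachSize t m + (m + genericBound t m))

heavyPart lightPart : ℕ → ℕ → ℕ
heavyPart t k with t ≤? k
... | yes _ = k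
... | no  _ = 0
lightPart t k with t ≤? k
... | yes _ = 0
... | no  _ = k

heavyPart+lightPart : ∀ t k → k ≡ heavyPart t k + lightPart t k
heavyPart+lightPart t k with t ≤? k
... | yes _ = ≡.sym (+-identityʳ k)
... | no  _ = ≡.refl

heavyPart-heavy : ∀ t k → heavyPart t k ≡ 0 ⊎ t ≤ heavyPart t k
heavyPart-heavy t k with t ≤? k
... | yes t≤k = inj₂ t≤k
... | no  _   = inj₁ ≡.refl

lightPart≤ : ∀ t k → lightPart t k ≤ t
lightPart≤ t k with t ≤? k
... | yes _   = z≤n
... | no  t≰k = <⇒≤ (≰⇒> t≰k)

lightPart≤*⊓1 : ∀ t k → lightPart t k ≤ t * (k ⊓ 1)
lightPart≤*⊓1 t k with t ≤? k
lightPart≤*⊓1 t k       | yes _   = z≤n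
lightPart≤*⊓1 t zero    | no  _   = z≤n
lightPart≤*⊓1 t (suc k) | no  t≰k = ≤-trans (<⇒≤ (≰⇒> t≰k)) (n≤n*[1+m⊓1] t k)

sum-≤-scale : ∀ {n} b (f g : Fin n → ℕ) → (∀ i → f i ≤ b * g i) → sum (tabulate f) ≤ b * sum (tabulate g)
sum-≤-scale {zero}  b f g f≤bg = z≤n
sum-≤-scale {suc n} b f g f≤bg = ≤-trans
  (+-mono-≤ (f≤bg zero) (sum-≤-scale b (f ∘ suc) (g ∘ suc) (f≤bg ∘ suc)))
  (≤-reflexive (≡.sym (*-distribˡ-+ b (g zero) _)))

-- `m i ⊓ 1` indicates a positive multiplicity, so its sum counts the values that occur. If every
-- entry were below `b`, the total would be at most `b * c`.
large-entry : ∀ {n} b c (m : Fin n → ℕ) → sum (tabulate (λ i → m i ⊓ 1)) ≤ c → b * c < sum (tabulate m) →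
  ∃[ i ] b ≤ m i
large-entry b c m few many with Fin.any? (λ i → b ≤? m i)
... | yes large = large
... | no  small = contradiction many (≤⇒≯ (≤-trans (sum-≤-scale b m _ bound) (*-monoʳ-≤ b few)))
  where
  bound : ∀ i → m i ≤ b * (m i ⊓ 1)
  bound i with m i | (λ b≤mi → small (i , b≤mi))
  ... | zero  | _   = z≤n
  ... | suc k | b≰k = ≤-trans (<⇒≤ (≰⇒> b≰k)) (n≤n*[1+m⊓1] b k)

-- The greedy steps leave over at most t * t + t elements, each of which uses up one
-- reserved element; the rest of the reserve allows t more greedy steps.
reserveSize distinctBound lengthBound : ℕ → ℕ
reserveSize   t = (t * t + t) + suc (t + t)
distinctBound t = genericBound t (reserveSize t)
lengthBound   t = suc (t * distinctBound t * t * distinctBound t)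

-- Choice of signs.

module Construction {c ℓ} (G : Group c ℓ) (_≟_ : Decidable₂ (Group._≈_ G)) (t : ℕ) (1≤t : 1 ≤ t)
                    (torsion : Multiples.TorsionFreeUpTo G (t * t + t * t)) where
  open Group G renaming (refl to ≈-refl; sym to ≈-sym; trans to ≈-trans; reflexive to ≈-reflexive)
  open GroupProperties G
  open Multiples G
  open Realizing G
  open Multiset G
  open Membership setoid using (_∈_; _∉_)
  open DecMembership (groupDecSetoid G _≟_) using (_∈?_)
  open Unique setoid using (Unique)
  open SetoidPermutation setoid using () renaming (_↭_ to _↭ₛ_; ↭-trans to ↭ₛ-trans; ↭-reflexive-≋ to ↭ₛ-reflexive-≋)
  open SetoidPermutationₚ setoid using () renaming (xs↭ys⇒|xs|≡|ys| to ↭ₛ-length; ∈-resp-↭ to ∈-resp-↭ₛ)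

  private
    t≤t*t : t ≤ t * t
    t≤t*t = ≤-trans (≤-reflexive (≡.sym (*-identityʳ t))) (*-monoʳ-≤ t 1≤t)

  ∙-swap-≈ε : ∀ {x y} → x ∙ y ≈ ε → y ∙ x ≈ ε
  ∙-swap-≈ε {x} {y} eq = ≈-trans (∙-congʳ (inverseʳ-unique x y eq)) (inverseˡ x)

  -- The requirement for placing a block of copies of `d` before copies of `a`. The case `i` = 0
  -- covers sums that stay inside the block of `d`.
  Compatible : Carrier → Carrier → Set _
  Compatible a d = ∀ {i j} → i ≤ t → j ≤ t → 1 ≤ j → ¬ (j · d ∙ i · a ≈ ε)

  compatible-self : ∀ {a} → ¬ (a ≈ ε) → Compatible a a
  compatible-self {a} a≉ε {i} {j} i≤t j≤t 1≤j eq = a≉ε (torsion (j + i) a (≤-trans 1≤j (m≤m+n j i))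
    (+-mono-≤ (≤-trans j≤t t≤t*t) (≤-trans i≤t t≤t*t)) (≈-trans (×-homo-+ a j i) eq))

  -- j y = − i a and j' y = i' a give (j i' + j' i) a = 0.
  opposite-relations : ∀ {a y i j i' j'} → i ≤ t → j ≤ t → 1 ≤ j → i' ≤ t → j' ≤ t → 1 ≤ j' →
    j · y ∙ i · a ≈ ε → j' · (y ⁻¹) ∙ i' · a ≈ ε → y ≈ ε
  opposite-relations {a} {y} {i} {j} {i'} {j'} i≤t j≤t 1≤j i'≤t j'≤t 1≤j' eq eq' =
    torsion j y 1≤j (≤-trans j≤t (≤-trans t≤t*t (m≤m+n _ _))) (≈-trans (≈-sym (identityʳ _))
      (≈-trans (∙-congˡ (≈-sym ia≈ε)) eq))
    where
    open SetoidReasoning setoid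
    j'y≈i'a : j' · y ≈ i' · a
    j'y≈i'a = ≈-sym (≈-trans (inverseʳ-unique _ _ eq')
      (≈-trans (⁻¹-cong (·-⁻¹ j' y)) (⁻¹-involutive _)))

    relation : (j * i' + j' * i) · a ≈ ε
    relation = begin
      (j * i' + j' * i) · a          ≈⟨ ×-homo-+ a (j * i') (j' * i) ⟩
      (j * i') · a ∙ (j' * i) · a    ≈⟨ ∙-cong (×-assocˡ a j i') (×-assocˡ a j' i) ⟨
      j · i' · a ∙ j' · i · a        ≈⟨ ∙-cong (×-congʳ j (≈-sym j'y≈i'a)) (×-congʳ j' (inverseʳ-unique _ _ eq)) ⟩
      j · j' · y ∙ j' · ((j · y) ⁻¹)   ≈⟨ ∙-cong (×-assocˡ y j j') (·-⁻¹ j' (j · y)) ⟩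
      (j * j') · y ∙ (j' · j · y) ⁻¹ ≈⟨ ∙-congˡ (⁻¹-cong (×-assocˡ y j' j)) ⟩
      (j * j') · y ∙ ((j' * j) · y) ⁻¹ ≡⟨ cong (λ n → (j * j') · y ∙ (n · y) ⁻¹) (*-comm j' j) ⟩
      (j * j') · y ∙ ((j * j') · y) ⁻¹ ≈⟨ inverseʳ _ ⟩
      ε                              ∎

    -- For positive `i` the coefficient lies between 1 and 2 t², so `a` itself is zero; in either
    -- case `j · y` vanishes, and hence `y`.
    cancel : ∀ i → i ≤ t → (j * i' + j' * i) · a ≈ ε → i · a ≈ ε
    cancel zero    _   _   = ≈-refl
    cancel (suc i) i≤t rel = ≈-trans (×-congʳ (suc i) (torsion (j * i' + j' * suc i) a
      (≤-trans (*-mono-≤ 1≤j' (s≤s z≤n)) (m≤n+m _ _))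
      (+-mono-≤ (*-mono-≤ j≤t i'≤t) (*-mono-≤ j'≤t i≤t)) rel)) (·-ε (suc i))

    ia≈ε : i · a ≈ ε
    ia≈ε = cancel i i≤t relation

  -- A bounded search decides whether some relation holds for `y`; if one does, `opposite-relations`
  -- rules out every relation for the inverse of `y`.
  compatible-sign : ∀ a {y} → ¬ (y ≈ ε) → Compatible a y ⊎ Compatible a (y ⁻¹)
  compatible-sign a {y} y≉ε
    with anyUpTo? (λ i → anyUpTo? (λ j → (1 ≤? j) ×-dec ((j · y ∙ i · a) ≟ ε)) (suc t)) (suc t)
  ... | no  none = inj₁ λ i≤t j≤t 1≤j eq → none (_ , s≤s i≤t , _ , s≤s j≤t , 1≤j , eq)
  ... | yes (i , s≤s i≤t , j , s≤s j≤t , 1≤j , eq) =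
    inj₂ λ i'≤t j'≤t 1≤j' eq' → y≉ε (opposite-relations i≤t j≤t 1≤j i'≤t j'≤t 1≤j' eq eq')

  -- Nonvanishing partial sums and blocks of equal elements.

  Σ : List Carrier → Carrier
  Σ []       = ε
  Σ (x ∷ xs) = x ∙ Σ xs

  Σ-++ : ∀ xs ys → Σ (xs ++ ys) ≈ Σ xs ∙ Σ ys
  Σ-++ []       ys = ≈-sym (identityˡ _)
  Σ-++ (x ∷ xs) ys = ≈-trans (∙-congˡ (Σ-++ xs ys)) (≈-sym (assoc _ _ _))

  -- `l` counts the terms after `x`, so the sums have `l + 1` ≤ t terms. Beyond the end of `s`,
  -- `take` returns all of `s` and adds no new condition.
  Clear : Carrier → List Carrier → Set ℓ
  Clear x s = ∀ l → l < t → ¬ (x ∙ Σ (take l s) ≈ ε)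

  -- The differences of a walk that visits no vertex twice within t steps.
  data Good : List Carrier → Set (c ⊔ ℓ) where
    []  : Good []
    _∷_ : ∀ {x s} → Clear x s → Good s → Good (x ∷ s)

  -- Under a block of copies of d, such an s only produces the sums j d + i a.
  Ready : Carrier → List Carrier → Set ℓ
  Ready a s = ∀ l → l < t → ∃[ i ] (i ≤ l × Σ (take l s) ≈ i · a)

  Ready-[] : ∀ {a} → Ready a []
  Ready-[] {a} l _ = 0 , z≤n , ≈-reflexive (cong Σ (take-[] l))

  take-block : ∀ l k d s →
    ∃[ i ] ∃[ l' ] (i + l' ≡ l × Σ (take l (replicate k d ++ s)) ≈ i · d ∙ Σ (take l' s))
  take-block l       zero    d s = 0 , l , ≡.refl , ≈-sym (identityˡ _)
  take-block zero    (suc k) d s = 0 , 0 , ≡.refl , ≈-sym (identityˡ _)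
  take-block (suc l) (suc k) d s with i , l' , eq , sum ← take-block l k d s =
    suc i , l' , cong suc eq , ≈-trans (∙-congˡ sum) (≈-sym (assoc _ _ _))

  Ready-++ : ∀ {a s} k → Ready a s → Ready a (replicate k a ++ s)
  Ready-++ {a} {s} k ready l l<t
    with i , l' , ≡.refl , sum ← take-block l k a s
    with i' , i'≤l' , sum' ← ready l' (≤-<-trans (m≤n+m l' i) l<t) =
    i + i' , +-monoʳ-≤ i i'≤l' , ≈-trans sum (≈-trans (∙-congˡ sum') (≈-sym (×-homo-+ a i i')))

  Ready-block : ∀ {a s} k → t ≤ k → Ready a (replicate k a ++ s)
  Ready-block {a} {s} k t≤k l l<t = l , ≤-refl , go l k (≤-trans (<⇒≤ l<t) t≤k)
    where
    go : ∀ l k → l ≤ k → Σ (take l (replicate k a ++ s)) ≈ l · a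
    go zero    k       _         = ≈-refl
    go (suc l) (suc k) (s≤s l≤k) = ∙-congˡ (go l k l≤k)

  -- As `s` is ready for `a`, a sum starting inside the block has the form j d + i a with j
  -- positive, which compatibility excludes.
  Good-block : ∀ {a d s} k → Compatible a d → Ready a s → Good s → Good (replicate k d ++ s)
  Good-block             zero    _  _     good = good
  Good-block {a} {d} {s} (suc k) comp ready good =
    clear ∷ Good-block k comp ready good
    where
    clear : Clear d (replicate k d ++ s)
    clear l l<t eq
      with i , l' , ≡.refl , sum ← take-block l k d s
      with i' , i'≤l' , sum' ← ready l' (≤-<-trans (m≤n+m l' i) l<t) =
      comp {i'} {suc i} (≤-trans i'≤l' (≤-trans (m≤n+m l' i) (<⇒≤ l<t))) (≤-<-trans (m≤m+n i l') l<t) (s≤s z≤n)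
        (≈-trans (assoc _ _ _) (≈-trans (∙-congˡ (≈-trans (∙-congˡ (≈-sym sum')) (≈-sym sum))) eq))

  -- A sum that stops before `d` is a short positive multiple of `a`. One that passes `d` reads j a
  -- + d + i a; a cyclic rotation keeps it zero and turns it into d + (i + j) a, which compatibility
  -- excludes.
  Good-block-after : ∀ {a d s} k → ¬ (a ≈ ε) → Compatible a d → Ready a s → Good (d ∷ s) →
    Good (replicate k a ++ d ∷ s)
  Good-block-after             zero    _   _    _     good = good
  Good-block-after {a} {d} {s} (suc k) a≉ε comp ready good =
    clear ∷ Good-block-after k a≉ε comp ready good
    where
    clear : Clear a (replicate k a ++ d ∷ s)
    clear l l<t eq with take-block l k a (d ∷ s)
    ... | i , zero , ≡.refl , sum =
      compatible-self a≉ε {0} {suc i} z≤n (≤-<-trans (m≤m+n i 0) l<t) (s≤s z≤n)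
        (≈-trans (assoc _ _ _) (≈-trans (∙-congˡ (≈-sym sum)) eq))
    ... | i , suc l' , ≡.refl , sum
      with i' , i'≤l' , sum' ← ready l' (≤-trans (s≤s (≤-trans (n≤1+n l') (m≤n+m (suc l') i))) l<t) =
      comp {i' + suc i} {1}
        (≤-trans (+-monoˡ-≤ (suc i) i'≤l') (≤-trans
          (≤-reflexive (≡.trans (+-comm l' (suc i)) (≡.sym (+-suc i l')))) (<⇒≤ l<t)))
        1≤t (s≤s z≤n) (begin
          1 · d ∙ (i' + suc i) · a           ≈⟨ ∙-cong (identityʳ d) (×-homo-+ a i' (suc i)) ⟩
          d ∙ (i' · a ∙ suc i · a)           ≈⟨ assoc _ _ _ ⟨
          (d ∙ i' · a) ∙ suc i · a           ≈⟨ ∙-swap-≈ε (begin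
            suc i · a ∙ (d ∙ i' · a)         ≈⟨ assoc _ _ _ ⟩
            a ∙ (i · a ∙ (d ∙ i' · a))       ≈⟨ ∙-congˡ (∙-congˡ (∙-congˡ sum')) ⟨
            a ∙ (i · a ∙ (d ∙ Σ (take l' s))) ≈⟨ ∙-congˡ sum ⟨
            a ∙ Σ (take l (replicate k a ++ d ∷ s)) ≈⟨ eq ⟩
            ε                                ∎) ⟩
          ε                                  ∎)
      where open SetoidReasoning setoid

  -- Each block gets the sign compatible with the element `b` for which the list built so far is
  -- ready. Having length at least `t`, it hides everything behind it, and the list becomes ready
  -- for the new signed element.
  heavyBlocks : ∀ {n} (x : Fin n → Carrier) (h : Fin n → ℕ) → (∀ i → NonIdentity G (x i)) →
    (∀ i → h i ≡ 0 ⊎ t ≤ h i) → ∀ {a s} → Ready a s → Good s →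
    ∃[ ds ] (Good (ds ++ s) × ds ≈± multiset G x h × ∃[ b ] Ready b (ds ++ s))
  heavyBlocks {zero}  x h x≉ε heavy {a} ready good = [] , good , ≈±-refl , a , ready
  heavyBlocks {suc n} x h x≉ε heavy {s = s} ready good
    with ds , good' , ds≈ , b , ready' ← heavyBlocks (x ∘ suc) (h ∘ suc) (x≉ε ∘ suc) (heavy ∘ suc) ready good
    with h zero | heavy zero
  ... | .0 | inj₁ ≡.refl = ds , good' , ds≈ , b , ready'
  ... | k  | inj₂ t≤k =
    [ place ≈±-refl , place ≈±-inverse ]′ (compatible-sign b (x≉ε zero))
    where
    place : ∀ {d} → d ∷ [] ≈± x zero ∷ [] → Compatible b d →
      ∃[ ds ] (Good (ds ++ s) × ds ≈± replicate k (x zero) ++ multiset G (x ∘ suc) (h ∘ suc) × ∃[ b ] Ready b (ds ++ s))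
    place {d} d≈ comp = replicate k d ++ ds ,
      subst Good (≡.sym (++-assoc (replicate k d) ds _)) (Good-block k comp ready' good') ,
      ≈±-++ (≈±-replicate k d≈) ds≈ ,
      d , subst (Ready d) (≡.sym (++-assoc (replicate k d) ds _)) (Ready-block k t≤k)

  -- Each signed `y` is followed up by `t` copies of `a`, which make the list ready for `a` again;
  -- this is the price of `t` copies per element of `Y`.
  interleave : ∀ {a s} Y → NonIdentity G a → All (NonIdentity G) Y → Ready a s → Good s →
    ∃[ ds ] (Good (ds ++ s) × Ready a (ds ++ s) × ds ≈± Y ++ replicate (length Y * t) a)
  interleave []      _   _           ready good = [] , good , ready , ≈±-refl
  interleave {a} {s} (y ∷ Y) a≉ε (y≉ε ∷ Y≉ε) ready good
    with ds , good' , ready' , ds≈ ← interleave Y a≉ε Y≉ε ready good =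
    [ place ≈±-refl , place ≈±-inverse ]′ (compatible-sign a y≉ε)
    where
    place : ∀ {d} → d ∷ [] ≈± y ∷ [] → Compatible a d →
      ∃[ ds ] (Good (ds ++ s) × Ready a (ds ++ s) × ds ≈± y ∷ Y ++ replicate (t + length Y * t) a)
    place {d} d≈ comp = replicate t a ++ d ∷ ds ,
      subst Good (≡.sym (++-assoc (replicate t a) (d ∷ ds) s))
        (Good-block-after t a≉ε comp ready' (Good-block 1 comp ready' good')) ,
      subst (Ready a) (≡.sym (++-assoc (replicate t a) (d ∷ ds) s)) (Ready-block t ≤-refl) ,
      ≈±-trans (≈±-++ ≈±-refl (≈±-++ d≈ ds≈))
        (↭⇒≈± (trans (↭.shifts (replicate t a) (y ∷ Y)) (↭.++⁺ˡ (y ∷ Y)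
          (↭-reflexive (≡.sym (replicate-+ t (length Y * t)))))))

  -- Greedy extension.

  Unique-resp-↭ : ∀ {xs ys} → xs ↭ ys → Unique xs → Unique ys
  Unique-resp-↭ p = SetoidPermutationₚ.Unique-resp-↭ setoid (↭⇒↭ₛ′ isEquivalence p)

  pick : ∀ {U} F → Unique U → length F < length U →
    ∃[ x ] ∃[ U' ] (U ↭ x ∷ U' × x ∉ F × Unique U')
  pick {U} F U! F<U with extract (λ x → ¬? (x ∈? F)) U
  ... | inj₁ (x , U' , U↭ , x∉F) with _ ∷ U'! ← Unique-resp-↭ U↭ U! = x , U' , U↭ , x∉F , U'!
  ... | inj₂ all∈F = contradiction F<U (≤⇒≯ (Unique-⊆⇒length-≤ setoid F U! sub))
    where
    sub : ∀ {z} → z ∈ U → z ∈ F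
    sub {z} z∈ with z ∈? F
    ... | yes z∈F = z∈F
    ... | no  z∉F = contradiction z∈ (Membershipₚ.All[≉]⇒∉ setoid (All.map
            (λ ¬x∉F z≈x → ¬x∉F (z∉F ∘ Membershipₚ.∈-resp-≈ setoid (≈-sym z≈x))) all∈F))

  -- Exactly the elements that cannot be prepended to `s`. As the list has `t` entries, any `t + 1`
  -- distinct candidates include an admissible one.
  blocked : List Carrier → List Carrier
  blocked s = applyUpTo (λ l → (Σ (take l s)) ⁻¹) t

  length-blocked : ∀ s → length (blocked s) ≡ t
  length-blocked s = length-applyUpTo _ t

  ∉-blocked⇒Clear : ∀ {x s} → x ∉ blocked s → Clear x s
  ∉-blocked⇒Clear {x} x∉ l l<t eq = x∉ (Membershipₚ.∈-resp-≈ setoid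
    (≈-sym (inverseˡ-unique x _ eq)) (Membershipₚ.∈-applyUpTo⁺ setoid _ l<t))

  greedy : ∀ k {U s} → length U ≤ k + t → Unique U → Good s →
    ∃[ new ] ∃[ Y ] (Good (new ++ s) × U ↭ new ++ Y × length Y ≤ t)
  greedy zero    {U}     U≤ U! good = [] , U , good , refl , U≤
  greedy (suc k) {U} {s} U≤ U! good with length U ≤? t
  ... | yes U≤t = [] , U , good , refl , U≤t
  ... | no  U≰t
    with x , U' , U↭ , x∉ , U'! ← pick (blocked s) U!
           (subst (_< length U) (≡.sym (length-blocked s)) (≰⇒> U≰t))
    with new , Y , good' , U'↭ , Y≤t ← greedy k {U'} {x ∷ s}
           (≤-pred (≤-trans (≤-reflexive (≡.sym (↭.↭-length U↭))) U≤)) U'! (∉-blocked⇒Clear x∉ ∷ good)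
    = new ++ x ∷ [] , Y , subst Good (≡.sym (++-assoc new (x ∷ []) s)) good' ,
      trans U↭ (trans (prep x U'↭) (trans (↭-sym (↭.shift x new Y))
        (↭-reflexive (≡.sym (++-assoc new (x ∷ []) Y))))) , Y≤t

  -- Multiplicities up to `b` decompose into `b` layers of distinct elements, and `greedy` leaves at
  -- most `t` elements of each layer.
  greedyLayers : ∀ b {n} (x : Fin n → Carrier) (m : Fin n → ℕ) → (∀ {i j} → x i ≈ x j → i ≡ j) →
    (∀ i → m i ≤ b) → ∀ {s} → Good s →
    ∃[ new ] ∃[ Y ] (Good (new ++ s) × multiset G x m ↭ new ++ Y × length Y ≤ b * t)
  greedyLayers zero    x m inj m≤0 good =
    [] , [] , good , ↭-reflexive (multiset-zero x m≤0) , z≤n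
  greedyLayers (suc b) x m inj m≤b {s} good
    with new , Y , good' , U↭ , Y≤ ← greedy _ (m≤m+n _ t)
           (Unique-multiset x (λ i → m i ⊓ 1) inj (λ i → m⊓n≤n (m i) 1)) good
    with new' , Y' , good'' , M↭ , Y'≤ ← greedyLayers b x (λ i → m i ∸ 1) inj (λ i → ∸-monoˡ-≤ 1 (m≤b i)) good'
    = new' ++ new , Y' ++ Y , subst Good (≡.sym (++-assoc new' new s)) good'' ,
      trans (multiset-+ x (m≡m⊓1+[m∸1] ∘ m))
        (trans (↭.++-comm (multiset G x (λ i → m i ⊓ 1)) _) (trans (↭.++⁺ M↭ U↭) (++-interchange new' Y' new Y))) ,
      ≤-trans (≤-reflexive (length-++ Y')) (≤-trans (+-mono-≤ Y'≤ Y≤) (≤-reflexive (+-comm (b * t) t)))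

  -- A reserve without short vanishing sums.

  reach : ℕ → List Carrier → List Carrier
  reach zero    P = ε ∷ []
  reach (suc k) P = ε ∷ cartesianProductWith _∙_ P (reach k P)

  -- Both sides count the words of length at most `k` over `P`: 1 + m + ... + m^k, where m is the
  -- length of `P`.
  length-reach : ∀ k P → length (reach k P) ≡ reachSize k (length P)
  length-reach zero    P = ≡.refl
  length-reach (suc k) P = cong suc (≡.trans (length-cartesianProductWith _∙_ P (reach k P))
    (cong (length P *_) (length-reach k P)))

  Σ∈reach : ∀ {k P u} → All (_∈≡ P) u → length u ≤ k → Σ u ∈≡ reach k P
  Σ∈reach {zero}  []          _       = here ≡.refl
  Σ∈reach {suc k} []          _       = here ≡.refl
  Σ∈reach {suc k} (x∈ ∷ u∈)   (s≤s u≤) = there (∈≡.∈-cartesianProductWith⁺ _∙_ x∈ (Σ∈reach u∈ u≤))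

  -- u + e + v = 0 forces e = − u − v.
  relators : List Carrier → List Carrier
  relators P = cartesianProductWith (λ x y → x ⁻¹ ∙ y ⁻¹) (reach t P) (reach t P)

  reserve-bound : ∀ P → length P + length (relators P) < genericBound t (suc (length P))
  reserve-bound P = begin-strict
    length P + length (relators P)                  ≡⟨ cong (length P +_) (length-cartesianProductWith _ (reach t P) _) ⟩
    length P + length (reach t P) * length (reach t P) ≡⟨ cong (λ k → length P + k * k) (length-reach t P) ⟩
    length P + r * r                                ≡⟨ +-comm (length P) (r * r) ⟩
    r * r + length P                                ≤⟨ +-monoʳ-≤ (r * r) (m≤m+n _ _) ⟩
    r * r + (length P + genericBound t (length P))  <⟨ ≤-refl ⟩
    genericBound t (suc (length P))                 ∎
    where
    open ≤-Reasoning
    r = reachSize t (length P)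

  data Generic : List Carrier → Set (c ⊔ ℓ) where
    []  : Generic []
    _∷_ : ∀ {e P} → e ∉ relators P → Generic P → Generic (e ∷ P)

  extractGeneric : ∀ m {U} → Unique U → genericBound t m ≤ length U →
    ∃[ P ] ∃[ Q ] (U ↭ P ++ Q × length P ≡ m × Generic P × Unique Q)
  extractGeneric zero    {U} U! _     = [] , U , refl , ≡.refl , [] , U!
  extractGeneric (suc m) {U} U! bound
    with P , Q , U↭ , ≡.refl , gen , Q! ← extractGeneric m U!
           (≤-trans (m≤n+m _ m) (≤-trans (m≤n+m _ (suc (reachSize t m * reachSize t m))) bound))
    with e , Q' , Q↭ , e∉ , Q'! ← pick (relators P) Q! (+-cancelˡ-< (length P) _ _
           (≤-trans (reserve-bound P) (≤-trans bound
             (≤-reflexive (≡.trans (↭.↭-length U↭) (length-++ P))))))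
    = e ∷ P , Q' , trans U↭ (trans (↭.++⁺ˡ P Q↭) (↭.shift e P Q')) , ≡.refl , e∉ ∷ gen , Q'!
  -- Entries of `P` outside `w` are discarded from the front until the head `e` occurs in `w`. All
  -- other terms of `w` then come from the tail, and a vanishing sum would make `e` one of the
  -- relators avoided when it was chosen.
  Generic⇒Σ≉ε : ∀ {P} w {v} → Generic P → w ++ v ↭ P → 1 ≤ length w → length w ≤ t → ¬ (Σ w ≈ ε)
  Generic⇒Σ≉ε {[]}    (_ ∷ _) _          perm _ _ _ = ↭.¬x∷xs↭[] perm
  Generic⇒Σ≉ε {e ∷ P} w {v}   (e∉ ∷ gen) perm 1≤w w≤t Σw≈ε
    with ∈≡.∈-++⁻ w (↭.∈-resp-↭ (↭-sym perm) (here ≡.refl))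
  ... | inj₂ e∈v with v₁ , v₂ , ≡.refl ← ∈≡.∈-∃++ e∈v =
    Generic⇒Σ≉ε w {v₁ ++ v₂} gen
      (trans (↭-reflexive (≡.sym (++-assoc w v₁ v₂)))
        (↭.drop-mid (w ++ v₁) [] (trans (↭-reflexive (++-assoc w v₁ _)) perm)))
      1≤w w≤t Σw≈ε
  ... | inj₁ e∈w with w₁ , w₂ , ≡.refl ← ∈≡.∈-∃++ e∈w =
    e∉ (Membershipₚ.∈-resp-≈ setoid (≈-sym e≈) (Any.map ≈-reflexive
      (∈≡.∈-cartesianProductWith⁺ _ (Σ∈reach w₁∈ w₁≤t) (Σ∈reach w₂∈ w₂≤t))))
    where
    perm' : w₁ ++ w₂ ++ v ↭ P
    perm' = ↭.drop-mid w₁ [] (trans (↭-reflexive (≡.sym (++-assoc w₁ (e ∷ w₂) v))) perm)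
    all∈ : All (_∈≡ P) (w₁ ++ w₂ ++ v)
    all∈ = All.tabulate (↭.∈-resp-↭ perm')
    w₁∈ = Allₚ.++⁻ˡ w₁ all∈
    w₂∈ = Allₚ.++⁻ˡ w₂ (Allₚ.++⁻ʳ w₁ all∈)
    w≡ : length w₁ + suc (length w₂) ≡ length (w₁ ++ e ∷ w₂)
    w≡ = ≡.sym (length-++ w₁)
    w₁≤t = ≤-trans (≤-trans (m≤m+n _ _) (≤-reflexive w≡)) w≤t
    w₂≤t = ≤-trans (≤-trans (n≤1+n _) (≤-trans (m≤n+m _ (length w₁)) (≤-reflexive w≡))) w≤t
    e≈ : e ≈ (Σ w₁) ⁻¹ ∙ (Σ w₂) ⁻¹
    e≈ = begin
      e                                ≈⟨ //-rightDividesʳ (Σ w₂) e ⟨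
      (e ∙ Σ w₂) ∙ (Σ w₂) ⁻¹           ≈⟨ ∙-congʳ (inverseʳ-unique (Σ w₁) _ (≈-trans (≈-sym (Σ-++ w₁ (e ∷ w₂))) Σw≈ε)) ⟩
      (Σ w₁) ⁻¹ ∙ (Σ w₂) ⁻¹            ∎
      where open SetoidReasoning setoid

  -- Spending the reserve.

  ∉-blocked-before⇒Clear : ∀ {y q s} → NonIdentity G y → q ∉ map (y ⁻¹ ∙_) (blocked s) → Clear y (q ∷ s)
  ∉-blocked-before⇒Clear {y} y≉ε q∉ zero _ eq = y≉ε (≈-trans (≈-sym (identityʳ y)) eq)
  ∉-blocked-before⇒Clear {y} {q} {s} y≉ε q∉ (suc l) l<t eq =
    -- A vanishing sum y + q + v, with v a partial sum of `s`, forces q = -y - v, a left translate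
    -- of a blocked element.
    q∉ (Membershipₚ.∈-resp-≈ setoid (≈-sym q≈)
      (Membershipₚ.∈-map⁺ setoid setoid ∙-congˡ (Membershipₚ.∈-applyUpTo⁺ setoid _ (<-trans (n<1+n l) l<t))))
    where
    q≈ : q ≈ y ⁻¹ ∙ (Σ (take l s)) ⁻¹
    q≈ = ≈-trans (≈-sym (//-rightDividesʳ (Σ (take l s)) q)) (∙-congʳ (inverseʳ-unique y _ eq))

  length-blocked² : ∀ y s → length (blocked s ++ map (y ⁻¹ ∙_) (blocked s)) ≡ t + t
  length-blocked² y s = ≡.trans (length-++ (blocked s))
    (cong₂ _+_ (length-blocked s) (≡.trans (length-map _ (blocked s)) (length-blocked s)))

  -- q ∈ R is chosen so that y is admissible right after it.
  mix : ∀ {R s} Y → All (NonIdentity G) Y → Unique R → length Y + suc (t + t) ≤ length R → Good s →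
    ∃[ new ] ∃[ R' ] ∃[ Z ] (Good (new ++ s) × new ++ R' ↭ Y ++ R × Z ++ R' ↭ R × suc (t + t) ≤ length R' × Unique R')
  mix {R} [] _ R! R≥ good = [] , R , [] , good , refl , refl , R≥ , R!
  mix {R} {s} (y ∷ Y) (y≉ε ∷ Y≉ε) R! R≥ good
    -- At most 2 t values are forbidden: the first list keeps `q` admissible before `s`, the second
    -- keeps `y` admissible before `q`. Hence the margin `suc (t + t)`.
    with q , R₁ , R↭ , q∉ , R₁! ← pick {R} (blocked s ++ map (y ⁻¹ ∙_) (blocked s)) R!
           (≤-trans (s≤s (≤-reflexive (length-blocked² y s)))
             (≤-trans (m≤n+m (suc (t + t)) (suc (length Y))) R≥))
    with new , R' , Z , good' , new↭ , Z↭ , R'≥ , R'! ← mix {R₁} {y ∷ q ∷ s} Y Y≉ε R₁!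
           (≤-pred (≤-trans R≥ (≤-reflexive (↭.↭-length R↭))))
           (∉-blocked-before⇒Clear y≉ε (q∉ ∘ Membershipₚ.∈-++⁺ʳ setoid (blocked s)) ∷
            ∉-blocked⇒Clear (q∉ ∘ Membershipₚ.∈-++⁺ˡ setoid) ∷ good)
    -- `Z` records the reserved elements spent so far.
    = new ++ y ∷ q ∷ [] , R' , q ∷ Z , subst Good (≡.sym (++-assoc new (y ∷ q ∷ []) s)) good' ,
      (let open PermutationReasoning in begin
        (new ++ y ∷ q ∷ []) ++ R'    ≡⟨ ++-assoc new (y ∷ q ∷ []) R' ⟩
        new ++ y ∷ q ∷ R'            ↭⟨ ↭.shifts new (y ∷ q ∷ []) ⟩
        y ∷ q ∷ new ++ R'            ↭⟨ prep y (prep q new↭) ⟩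
        y ∷ q ∷ Y ++ R₁              ↭⟨ prep y (↭.shift q Y R₁) ⟨
        y ∷ Y ++ q ∷ R₁              ↭⟨ prep y (↭.++⁺ˡ Y R↭) ⟨
        y ∷ Y ++ R                   ∎) ,
      trans (prep q Z↭) (↭-sym R↭) , R'≥ , R'!

  -- Before each of the `j` steps more than `t` distinct elements remain, so one of them is not
  -- blocked.
  advance : ∀ j {R s} → Unique R → j + t ≤ length R → Good s →
    ∃[ W ] ∃[ R' ] (length W ≡ j × Good (W ++ s) × W ++ R' ↭ R)
  advance zero    {R}     R! R≥ good = [] , R , ≡.refl , good , refl
  advance (suc j) {R} {s} R! R≥ good
    with q , R₁ , R↭ , q∉ , R₁! ← pick (blocked s) R!
           (≤-trans (s≤s (≤-trans (≤-reflexive (length-blocked s)) (m≤n+m t j))) R≥)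
    with W , R' , ≡.refl , good' , W↭ ← advance j R₁!
           (≤-pred (≤-trans R≥ (≤-reflexive (↭.↭-length R↭)))) (∉-blocked⇒Clear q∉ ∷ good)
    = W ++ q ∷ [] , R' , ≡.trans (length-++ W) (+-comm (length W) 1) ,
      subst Good (≡.sym (++-assoc W (q ∷ []) s)) good' ,
      trans (↭-reflexive (++-assoc W (q ∷ []) R')) (trans (↭.shift q W R') (trans (prep q W↭) (↭-sym R↭)))

  -- Since W is long enough, no block of at most t differences meets both R and s.
  Good-Generic : ∀ {P} R {W v s} → Generic P → t ≤ length W → (R ++ W) ++ v ↭ P → Good (W ++ s) → Good (R ++ W ++ s)
  Good-Generic []      gen t≤W perm good = good
  Good-Generic {P} (e ∷ R) {W} {v} {s} gen t≤W perm good =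
    clear ∷ Good-Generic R {W} {e ∷ v} gen t≤W (trans (↭.shift e (R ++ W) v) perm) good
    where
    clear : Clear e (R ++ W ++ s)
    clear l l<t eq = Generic⇒Σ≉ε (e ∷ take l (R ++ W)) {drop l (R ++ W) ++ v} gen
      (trans (prep e (↭-reflexive (≡.trans (≡.sym (++-assoc (take l (R ++ W)) _ v))
        (cong (_++ v) (take++drop≡id l (R ++ W)))))) perm)
      (s≤s z≤n)
      (≤-trans (s≤s (≤-trans (≤-reflexive (length-take l (R ++ W))) (m⊓n≤m l _))) l<t)
      (≈-trans (∙-congˡ (≈-reflexive (cong Σ (≡.trans (≡.sym (take-++ˡ l (R ++ W) l≤))
        (cong (take l) (++-assoc R W s)))))) eq)
      where
      l≤ : l ≤ length (R ++ W)
      l≤ = ≤-trans (<⇒≤ l<t) (≤-trans t≤W (≤-trans (m≤n+m _ (length R)) (≤-reflexive (≡.sym (length-++ R)))))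

  -- The cases of many and of few distinct elements.

  Unique-++⁻ˡ : ∀ xs {ys} → Unique (xs ++ ys) → Unique xs
  Unique-++⁻ˡ []       _         = []
  Unique-++⁻ˡ (x ∷ xs) (x∉ ∷ u)  = Allₚ.++⁻ˡ xs x∉ ∷ Unique-++⁻ˡ xs u

  -- One copy of each occurring element, `m i ⊓ 1`, is set aside to form the reserve `P` and its
  -- complement `Q`; only the remaining multiplicities `m i ∸ 1` are split into heavy and light
  -- parts.
  many-distinct : ∀ {n} (x : Fin n → Carrier) (m : Fin n → ℕ) → Injective _≡_ _≈_ x →
    (∀ i → NonIdentity G (x i)) → distinctBound t ≤ length (multiset G x (λ i → m i ⊓ 1)) →
    ∃[ ds ] (Good ds × ds ≈± multiset G x m)
  many-distinct x m inj x≉ε many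
    with P , Q , U↭ , |P| , gen , Q! ← extractGeneric (reserveSize t)
           (Unique-multiset x (λ i → m i ⊓ 1) inj (λ i → m⊓n≤n (m i) 1)) many
    -- The empty list is ready for every element. With `ε`, compatibility merely says that no
    -- multiple of the block's element by 1 to `t` vanishes.
    with ds₁ , good₁ , ds₁≈ , _ ← heavyBlocks x (λ i → heavyPart t (m i ∸ 1)) x≉ε
           (λ i → heavyPart-heavy t (m i ∸ 1)) (Ready-[] {ε}) []
    with ds₂ , Y₂ , good₂ , Q↭ , Y₂≤ ← greedy _ (m≤m+n _ t) Q! good₁
    with ds₃ , Y₃ , good₃ , light↭ , Y₃≤ ← greedyLayers t x (λ i → lightPart t (m i ∸ 1)) inj
           (λ i → lightPart≤ t (m i ∸ 1)) good₂
    with P! ← Unique-++⁻ˡ P (Unique-resp-↭ U↭ (Unique-multiset x (λ i → m i ⊓ 1) inj (λ i → m⊓n≤n (m i) 1)))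
    with ds₄ , R , Z , good₄ , ds₄↭ , Z↭ , R≥ , R! ← mix {P} (Y₃ ++ Y₂)
           (Allₚ.++⁺
             (Allₚ.++⁻ʳ ds₃ (↭.All-resp-↭ light↭ (All-multiset x _ x≉ε)))
             (Allₚ.++⁻ʳ ds₂ (↭.All-resp-↭ Q↭ (Allₚ.++⁻ʳ P (↭.All-resp-↭ U↭ (All-multiset x _ x≉ε))))))
           P!
           (≤-trans (+-monoˡ-≤ (suc (t + t)) (≤-trans (≤-reflexive (length-++ Y₃)) (+-mono-≤ Y₃≤ Y₂≤)))
             (≤-reflexive (≡.sym |P|)))
           good₃
    with W , R' , |W| , good₅ , W↭ ← advance t R! (≤-trans (n≤1+n _) R≥) good₄
    = R' ++ W ++ ds₄ ++ ds₃ ++ ds₂ ++ ds₁ ++ [] ,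
      -- The spent elements `Z` complete `R' ++ W` to `P`, so sums inside `R' ++ W` are covered by
      -- the genericity of `P`.
      Good-Generic R' {W} {Z} gen (≤-reflexive (≡.sym |W|))
        (trans (↭.++-comm (R' ++ W) Z) (trans (↭.++⁺ˡ Z (trans (↭.++-comm R' W) W↭)) Z↭)) good₅ ,
      ≈±-trans (↭⇒≈± (reassemble {R' = R'} {W} {ds₃ = ds₃} {ds₂} {Y₃ = Y₃} {Y₂} W↭ ds₄↭ light↭ Q↭))
        (≈±-trans (≈±-++ (≈±-++ (≈±-refl {light}) ds₁≈) (≈±-refl {Q ++ P}))
        (↭⇒≈± (let open PermutationReasoning in begin
          (light ++ heavy) ++ (Q ++ P)   ↭⟨ ↭.++⁺ (↭.++-comm light heavy) (↭.++-comm Q P) ⟩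
          (heavy ++ light) ++ (P ++ Q)   ↭⟨ ↭.++⁺ (multiset-+ x (λ i → heavyPart+lightPart t (m i ∸ 1))) U↭ ⟨
          multiset G x (λ i → m i ∸ 1) ++ multiset G x (λ i → m i ⊓ 1)
            ↭⟨ ↭.++-comm (multiset G x (λ i → m i ∸ 1)) _ ⟩
          multiset G x (λ i → m i ⊓ 1) ++ multiset G x (λ i → m i ∸ 1)
            ↭⟨ multiset-+ x (m≡m⊓1+[m∸1] ∘ m) ⟨
          multiset G x m                 ∎)))
    where
    light heavy : List Carrier
    light = multiset G x (λ i → lightPart t (m i ∸ 1))
    heavy = multiset G x (λ i → heavyPart t (m i ∸ 1))

  -- There are at most `t * distinctBound t` light elements, and each costs `t` copies of one
  -- frequent element. `lengthBound` is what the pigeonhole principle requires for an element of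
  -- that multiplicity.
  few-distinct : ∀ {n} (x : Fin n → Carrier) (m : Fin n → ℕ) →
    (∀ i → NonIdentity G (x i)) → length (multiset G x (λ i → m i ⊓ 1)) ≤ distinctBound t →
    lengthBound t ≤ sum (tabulate m) →
    ∃[ ds ] (Good ds × ds ≈± multiset G x m)
  few-distinct {zero}  x m x≉ε few ()
  few-distinct {suc n} x m x≉ε few many
    with i , large ← large-entry (t * distinctBound t * t) (distinctBound t) m
           (subst (_≤ distinctBound t) (length-multiset x (λ i → m i ⊓ 1)) few) many
    = build i large
    where
    build : ∀ i → t * distinctBound t * t ≤ m i → ∃[ ds ] (Good ds × ds ≈± multiset G x m)
    build i large =
      let
        -- The `e` copies of `a` that separate no light element form the final block of the walk.
        ds₁ , good₁ , ready₁ , ds₁≈ = interleave Y a≉ε (All-multiset x' _ (x≉ε ∘ punchIn i))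
          (Ready-++ e (Ready-[] {a})) (Good-block e (compatible-self a≉ε) Ready-[] [])
        ds₂ , good₂ , ds₂≈ , _ = heavyBlocks x' (λ j → heavyPart t (m' j)) (x≉ε ∘ punchIn i)
          (λ j → heavyPart-heavy t (m' j)) ready₁ good₁
      in ds₂ ++ ds₁ ++ replicate e a ++ [] , good₂ ,
        ≈±-trans (≈±-++ ds₂≈ (≈±-++ ds₁≈ (≈±-refl {replicate e a ++ []}))) (↭⇒≈± (begin
          H ++ (Y ++ replicate (length Y * t) a) ++ replicate e a ++ []
            ≡⟨ cong (H ++_) (++-assoc Y _ _) ⟩
          H ++ Y ++ replicate (length Y * t) a ++ replicate e a ++ []
            ≡⟨ ++-assoc H Y _ ⟨
          (H ++ Y) ++ replicate (length Y * t) a ++ replicate e a ++ []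
            ↭⟨ ↭.++⁺ (↭-sym (multiset-+ x' (λ j → heavyPart+lightPart t (m' j))))
                 (↭.++⁺ˡ (replicate (length Y * t) a) (↭.++-identityʳ _)) ⟩
          multiset G x' m' ++ replicate (length Y * t) a ++ replicate e a
            ≡⟨ cong (multiset G x' m' ++_) (replicate-+ (length Y * t) e) ⟨
          multiset G x' m' ++ replicate (length Y * t + e) a
            ≡⟨ cong (λ k → multiset G x' m' ++ replicate k a) (m+[n∸m]≡n |Y|*t≤) ⟩
          multiset G x' m' ++ replicate (m i) a
            ↭⟨ ↭.++-comm (multiset G x' m') _ ⟩
          replicate (m i) a ++ multiset G x' m'
            ↭⟨ multiset-remove x m i ⟨
          multiset G x m ∎))
      where
      open PermutationReasoning
      a = x i
      a≉ε = x≉ε i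
      x' = x ∘ punchIn i
      m' = m ∘ punchIn i
      Y = multiset G x' (λ j → lightPart t (m' j))
      H = multiset G x' (λ j → heavyPart t (m' j))
      e = m i ∸ length Y * t

      -- Each value other than `a` contributes at most `t` light copies, and these values are among
      -- the distinct elements of the whole multiset.
      |Y|≤ : length Y ≤ t * distinctBound t
      |Y|≤ = ≤-trans (≤-reflexive (length-multiset x' _)) (≤-trans
        (sum-≤-scale t _ (λ j → m' j ⊓ 1) (λ j → lightPart≤*⊓1 t (m' j)))
        (*-monoʳ-≤ t (≤-trans (≤-reflexive (≡.sym (length-multiset x' _)))
          (≤-trans (m≤n+m _ _) (≤-trans (≤-reflexive (≡.sym (≡.trans
            (↭.↭-length (multiset-remove x (λ j → m j ⊓ 1) i)) (length-++ (replicate (m i ⊓ 1) a))))) few)))))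

      |Y|*t≤ : length Y * t ≤ m i
      |Y|*t≤ = ≤-trans (*-monoˡ-≤ t |Y|≤) large

  differences : ∀ {n} (x : Fin n → Carrier) (m : Fin n → ℕ) → Injective _≡_ _≈_ x →
    (∀ i → NonIdentity G (x i)) → lengthBound t ≤ sum (tabulate m) →
    ∃[ ds ] (Good ds × ds ≈± multiset G x m)
  differences x m inj x≉ε many with distinctBound t ≤? length (multiset G x (λ i → m i ⊓ 1))
  ... | yes K≤ = many-distinct x m inj x≉ε K≤
  ... | no  K≰ = few-distinct x m x≉ε (<⇒≤ (≰⇒> K≰)) many

  -- From differences to walks.

  vertex : List Carrier → ℕ → Carrier
  vertex ds i = Σ (take i ds)

  vertex-suc : ∀ ds (i : Fin (length ds)) → vertex ds (suc (toℕ i)) ≈ vertex ds (toℕ i) ∙ lookup ds i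
  vertex-suc (d ∷ ds) zero    = ≈-trans (identityʳ d) (≈-sym (identityˡ d))
  vertex-suc (d ∷ ds) (suc i) = ≈-trans (∙-congˡ (vertex-suc ds i)) (≈-sym (assoc d _ _))

  -- Common first differences cancel, which reduces the claim to `i` = 0; there it is the `Clear`
  -- condition of the first difference.
  Good⇒vertex-≉ : ∀ {ds} → Good ds → ∀ {i j} → i < j → j ∸ i ≤ t → j ≤ length ds →
    ¬ (vertex ds i ≈ vertex ds j)
  Good⇒vertex-≉ (clear ∷ good) {zero}  {suc j} _         j≤t _        eq = clear j j≤t (≈-sym eq)
  Good⇒vertex-≉ (clear ∷ good) {suc i} {suc j} (s≤s i<j) j≤t (s≤s j≤) eq =
    Good⇒vertex-≉ good i<j j≤t j≤ (∙-cancelˡ _ _ _ eq)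
  Good⇒vertex-≉ []             {i}     {zero}  ()

  ±-cong : ∀ {xs ys} → Pointwise _≈_ xs ys → Pointwise _≈_ (± G xs) (± G ys)
  ±-cong []       = []
  ±-cong (p ∷ ps) = p ∷ ⁻¹-cong p ∷ ±-cong ps

  length-± : ∀ xs → length (± G xs) ≡ length xs * 2
  length-± []       = ≡.refl
  length-± (x ∷ xs) = cong (2 +_) (length-± xs)

  ≈±-length : ∀ {ds M} → ds ≈± M → length ds ≡ length M
  ≈±-length {ds} {M} ⟨ p ⟩ = *-cancelʳ-≡ _ _ 2
    (≡.trans (≡.sym (length-± ds)) (≡.trans (↭ₛ-length p) (length-± M)))

  ∈-±⁺ : ∀ {x xs} → x ∈ xs → x ∈ ± G xs
  ∈-±⁺ x∈ = Membershipₚ.∈-concatMap⁺ setoid setoid (Any.map here x∈)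

  -- The walk starts at zero. Its differences agree with `ds` up to `_≈_`, which yields `Δ↭±M`;
  -- adjacency follows because every difference is an entry of `Δ w`.
  differences⇒walk : ∀ {ds M k} → Good ds → ds ≈± M → k ≡ length ds →
    ∃[ w ] (IsRealization G M {k} w × LocallySimple G t w)
  differences⇒walk {ds} {M} good ⟨ ds↭M ⟩ ≡.refl = w ,
    record
      { isWalk = λ i → ∈-resp-↭ₛ Δ↭ (∈-±⁺ (Membershipₚ.∈-tabulate⁺ setoid i))
      ; Δ↭±M   = Δ↭
      } , simple
    where
    w : Fin (suc (length ds)) → Carrier
    w i = vertex ds (toℕ i)

    δ≈ : ∀ i → δ G w i ≈ lookup ds i
    δ≈ i = begin
      w (inject₁ i) ⁻¹ ∙ w (suc i)                 ≡⟨ cong (λ j → vertex ds j ⁻¹ ∙ w (suc i)) (Fin.toℕ-inject₁ i) ⟩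
      vertex ds (toℕ i) ⁻¹ ∙ w (suc i)             ≈⟨ ∙-congˡ (vertex-suc ds i) ⟩
      vertex ds (toℕ i) ⁻¹ ∙ (vertex ds (toℕ i) ∙ lookup ds i) ≈⟨ \\-leftDividesʳ _ _ ⟩
      lookup ds i                                  ∎
      where open SetoidReasoning setoid

    Δ↭ : Δ G w ↭ₛ ± G M
    Δ↭ = ↭ₛ-trans (↭ₛ-reflexive-≋ (±-cong (subst (Pointwise _≈_ _) (tabulate-lookup ds)
      (Pointwise.tabulate⁺ δ≈)))) ds↭M

    simple : LocallySimple G t w
    simple i j 1≤ ≤t eq with <-cmp (toℕ i) (toℕ j)
    ... | tri< i<j _ _ = Good⇒vertex-≉ good i<j (subst (_≤ t) (m≤n⇒∣m-n∣≡n∸m (<⇒≤ i<j)) ≤t)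
                           (≤-pred (Fin.toℕ<n j)) eq
    ... | tri≈ _ i≡j _ = contradiction 1≤ (≤⇒≯ (≤-reflexive (m≡n⇒∣m-n∣≡0 i≡j)))
    ... | tri> _ _ j<i = Good⇒vertex-≉ good j<i (subst (_≤ t) (m≤n⇒∣n-m∣≡n∸m (<⇒≤ j<i)) ≤t)
                           (≤-pred (Fin.toℕ<n i)) (≈-sym eq)

theorem3p3 : ∀ (c ℓ : Level) (t : ℕ) → 1 ≤ t →
    ∃[ L ]
    (∀ (G : Group c ℓ) (N p : ℕ) →
    HasOrder G N →
    IsSmallestPrimeDivisor p N →
    t * (2 * t + 1) < p →
    ∀ (n : ℕ) (a : Fin n → Group.Carrier G) (m : Fin n → ℕ) →
    Injective _≡_ (Group._≈_ G) a →
    (∀ i → NonIdentity G (a i)) →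
    L ≤ sum (tabulate m) →
    ∃[ w ] (IsRealization G (multiset G a m) {sum (tabulate m)} w
    × LocallySimple G t w))
theorem3p3 c ℓ t 1≤t = lengthBound t , λ G N p order p-smallest t[2t+1]<p n a m inj a≉0 long →
  let
    -- 2 t² bounds the coefficients arising in `opposite-relations`, and 2 t² + t = t (2 t + 1) < p.
    2t²<p : t * t + t * t < p
    2t²<p = ≤-<-trans (≤-trans (m≤m+n _ t) (≤-reflexive (2t²+t≡ t))) t[2t+1]<p
    open Construction G (HasOrder⇒≟ {G = G} order) t 1≤t
      (λ k x 1≤k k≤2t² → torsion-free-below {G = G} order p-smallest k x 1≤k (≤-<-trans k≤2t² 2t²<p))
    ds , good , ds≈M = differences a m inj a≉0 long
  in differences⇒walk good ds≈M
       (≡.sym (≡.trans (≈±-length ds≈M) (Multiset.length-multiset G a m)))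
  where
  2t²+t≡ : ∀ t → t * t + t * t + t ≡ t * (2 * t + 1)
  2t²+t≡ = solve-∀
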